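{- Let $n \ge 1$ be an integer, let $A \subset E_2^n$ be a subset with $|A| \ge 1$, and let $B \in J_A$, i.e. $B \subset E_2^n$ is isometric to $A$. Then: 1) $R(B) = 0$ if $|A| = 1$; 2) $\dfrac{4D_A}{|A|^2} \le R(B) \le \dfrac{D_A}{|A|-1}$ if $|A| > 1$ and $|A|$ is even; 3) $\dfrac{4D_A}{|A|^2-1} \le R(B) \le \dfrac{D_A}{|A|-1}$ if $|A| > 1$ and $|A|$ is odd.
   Context: $E_2^n = \{0,1\}^n$ is the $n$-dimensional binary cube, with Hamming distance $d_H(x,y)$ = number of coordinates in which $x$ and $y$ differ. A $k$-dimensional face of $E_2^n$ is the set of all vectors in $E_2^n$ having prescribed fixed values in some fixed $n-k$ coordinates. The rank $R(A)$ of a non-empty subset $A \subset E_2^n$ is the dimension of the smallest face containing $A$; equivalently, it is the number of coordinates that are not constant on $A$. Subsets $A, B \subset E_2^n$ are isometric if there is a bijection $\varphi : A \to B$ with $d_H(a,a') = d_H(\varphi(a),\varphi(a'))$ for all $a,a' \in A$; $J_A$ denotes the class of all subsets of $E_2^n$ isometric to $A$. $D_A = \sum_{\{x,y\} \subset A,\, x \ne y} d_H(x,y)$ is the sum of Hamming distances over all unordered pairs of distinct vectors of $A$. The inequalities are between real (rational) numbers. -}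

module Defs where

open import Data.Bool.Base using (Bool; true; false; T; if_then_else_)
open import Data.Bool.Properties using (_≟_; T?)
open import Data.List.Base using (List; []; _∷_; _++_; map; filter; length)
open import Data.List.Membership.Propositional using () renaming (_∈_ to _∈ₗ_)
open import Data.List.Membership.Propositional.Properties
  using (∈-map⁺; ∈-map⁻; ∈-++⁺ˡ; ∈-++⁺ʳ; ∈-filter⁺; ∈-filter⁻)
open import Data.List.Relation.Unary.All as All using (All; []; _∷_)
open import Data.List.Relation.Unary.AllPairs using ([]; _∷_)
open import Data.List.Relation.Unary.Any using (here; there)
open import Data.List.Relation.Unary.Unique.Propositional using (Unique)
import Data.List.Relation.Unary.Unique.Propositional.Properties as Unique
open import Data.Maybe.Base using (Maybe; just; nothing; is-nothing)
open import Data.Nat.Base using (ℕ; zero; suc; _∸_; _^_; _<_; NonZero; >-nonZero)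
open import Data.Nat.ListAction using (sum)
open import Data.Nat.Properties using (m^n≢0; m<n⇒0<n∸m; ^-monoˡ-<; <-trans; n<1+n)
open import Data.Product.Base using (∃; Σ; _×_; _,_; proj₁; proj₂; uncurry)
open import Data.Vec.Base using (Vec; []; _∷_; lookup; zip; count; countᵇ; tabulate)
open import Data.Vec.Properties using (∷-injectiveʳ; lookup∘tabulate)
open import Function.Base using (_∘_)
open import Function.Bundles using (_⤖_; module Bijection)
open import Relation.Binary.PropositionalEquality
  using (_≡_; refl; sym; trans; cong)
open import Relation.Nullary.Decidable using (yes; no; does; ¬?)

private
  variable
    n : ℕ

Cube : ℕ → Set
Cube n = Vec Bool n

dH : Cube n → Cube n → ℕ
dH x y = count (λ (a , b) → ¬? (a ≟ b)) (zip x y)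

-- Subsets are given by characteristic functions, so that membership proofs
-- are unique and `Elem A` has exactly one inhabitant per vector of A.

Subset : ℕ → Set
Subset n = Cube n → Bool

infix 4 _∈_

_∈_ : Cube n → Subset n → Set
x ∈ A = T (A x)

Elem : Subset n → Set
Elem A = ∃ λ x → x ∈ A

Isometric : Subset n → Subset n → Set
Isometric A B = Σ (Elem A ⤖ Elem B) λ φ →
  ∀ (a a′ : Elem A) →
    dH (proj₁ a) (proj₁ a′) ≡ dH (proj₁ (Bijection.to φ a)) (proj₁ (Bijection.to φ a′))

cube : ∀ n → List (Cube n)
cube zero    = [] ∷ []
cube (suc n) = map (false ∷_) (cube n) ++ map (true ∷_) (cube n)

elements : Subset n → List (Cube n)
elements {n} A = filter (λ x → T? (A x)) (cube n)

card : Subset n → ℕ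
card A = length (elements A)

-- On a duplicate-free list, each unordered pair of distinct entries is listed
-- exactly once.
pairs : ∀ {X : Set} → List X → List (X × X)
pairs []       = []
pairs (x ∷ xs) = map (x ,_) xs ++ pairs xs

D : Subset n → ℕ
D A = sum (map (uncurry dH) (pairs (elements A)))

∈-cube : (x : Cube n) → x ∈ₗ cube n
∈-cube []          = here refl
∈-cube (false ∷ x) = ∈-++⁺ˡ (∈-map⁺ (false ∷_) (∈-cube x))
∈-cube (true ∷ x)  = ∈-++⁺ʳ (map (false ∷_) (cube _)) (∈-map⁺ (true ∷_) (∈-cube x))

cube-unique : ∀ n → Unique (cube n)
cube-unique zero    = [] ∷ []
cube-unique (suc n) = Unique.++⁺
  (Unique.map⁺ ∷-injectiveʳ (cube-unique n))
  (Unique.map⁺ ∷-injectiveʳ (cube-unique n))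
  λ (p , q) → case (∈-map⁻ (false ∷_) p) (∈-map⁻ (true ∷_) q)
  where
  open import Data.Empty using (⊥)
  case : ∀ {v : Cube (suc n)} → (∃ λ x → x ∈ₗ cube n × v ≡ false ∷ x) →
         (∃ λ y → y ∈ₗ cube n × v ≡ true ∷ y) → ⊥
  case (_ , _ , refl) (_ , _ , ())

∈-elements⁺ : (A : Subset n) {x : Cube n} → x ∈ A → x ∈ₗ elements A
∈-elements⁺ A {x} = ∈-filter⁺ (λ y → T? (A y)) (∈-cube x)

∈-elements⁻ : (A : Subset n) {x : Cube n} → x ∈ₗ elements A → x ∈ A
∈-elements⁻ {n} A = proj₂ ∘ ∈-filter⁻ (λ y → T? (A y)) {xs = cube n}

elements-unique : (A : Subset n) → Unique (elements A)
elements-unique {n} A = Unique.filter⁺ (λ x → T? (A x)) (cube-unique n)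

-- `just b` prescribes the value b in a coordinate; `nothing` leaves it free.

Face : ℕ → Set
Face n = Vec (Maybe Bool) n

dim : Face n → ℕ
dim = countᵇ is-nothing

infix 4 _∈ᶠ_ _⊆ᶠ_

_∈ᶠ_ : Cube n → Face n → Set
x ∈ᶠ F = ∀ i b → lookup F i ≡ just b → lookup x i ≡ b

_⊆ᶠ_ : Subset n → Face n → Set
A ⊆ᶠ F = ∀ x → x ∈ A → x ∈ᶠ F

commonValue : List Bool → Maybe Bool
commonValue []       = nothing
commonValue (b ∷ bs) = if does (All.all? (b ≟_) bs) then just b else nothing

-- The empty set has no smallest face; the value there is immaterial.
smallestFace : Subset n → Face n
smallestFace A = tabulate λ i → commonValue (map (λ x → lookup x i) (elements A))

rank : Subset n → ℕ
rank A = dim (smallestFace A)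

private
  commonValue-sound : ∀ bs {b c} → commonValue bs ≡ just b → c ∈ₗ bs → c ≡ b
  commonValue-sound (b ∷ bs) eq m with All.all? (b ≟_) bs
  commonValue-sound (b ∷ bs) refl (here p)  | yes _ = p
  commonValue-sound (b ∷ bs) refl (there m) | yes h = sym (All.lookup h m)
  commonValue-sound (b ∷ bs) ()   m         | no _

  commonValue-complete : ∀ bs {b c} → c ∈ₗ bs → (∀ {d} → d ∈ₗ bs → d ≡ b) →
                         commonValue bs ≡ just b
  commonValue-complete (b′ ∷ bs) _ h with All.all? (b′ ≟_) bs
  ... | yes _ = cong just (h (here refl))
  ... | no ¬p with () ← ¬p (All.tabulate λ m → trans (h (here refl)) (sym (h (there m))))

⊆-smallestFace : (A : Subset n) → A ⊆ᶠ smallestFace A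
⊆-smallestFace A x x∈A i b eq =
  commonValue-sound (map (λ y → lookup y i) (elements A))
    (trans (sym (lookup∘tabulate _ i)) eq)
    (∈-map⁺ (λ y → lookup y i) (∈-elements⁺ A x∈A))

smallestFace-least : (A : Subset n) → Elem A → (F : Face n) → A ⊆ᶠ F →
                     ∀ x → x ∈ᶠ smallestFace A → x ∈ᶠ F
smallestFace-least A (a , a∈A) F A⊆F x x∈S i b Fi≡b = x∈S i b
  (trans (lookup∘tabulate _ i)
    (commonValue-complete (map (λ y → lookup y i) (elements A))
      (∈-map⁺ (λ y → lookup y i) (∈-elements⁺ A a∈A))
      λ m → prescribed (∈-map⁻ (λ y → lookup y i) m)))
  where
  prescribed : ∀ {d} → (∃ λ y → y ∈ₗ elements A × d ≡ lookup y i) → d ≡ b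
  prescribed (y , y∈ , refl) = A⊆F y (∈-elements⁻ A y∈) i b Fi≡b

1<m⇒m∸1≢0 : ∀ {m} → 1 < m → NonZero (m ∸ 1)
1<m⇒m∸1≢0 1<m = >-nonZero (m<n⇒0<n∸m 1<m)

1<m⇒m^2≢0 : ∀ {m} → 1 < m → NonZero (m ^ 2)
1<m⇒m^2≢0 {m} 1<m = m^n≢0 m 2 {{>-nonZero (<-trans (n<1+n 0) 1<m)}}

1<m⇒m^2∸1≢0 : ∀ {m} → 1 < m → NonZero (m ^ 2 ∸ 1)
1<m⇒m^2∸1≢0 1<m = >-nonZero (m<n⇒0<n∸m (^-monoˡ-< 2 1<m))

{-# OPTIONS --safe #-}
module Submission where

-- An isometry carries the vectors of A onto those of B, so |A| = |B| and D_A = D_B.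
-- For B both D and the rank are sums over coordinates: a coordinate in which s of the
-- m = s + t vectors are 1 and t are 0 contributes s t to D, and it contributes 1 to the
-- rank when s, t > 0 and 0 otherwise. In the former case m - 1 ≤ s t ≤ m²/4, and
-- 4 s t ≤ m² - 1 when m is odd, as then s ≠ t; in the latter s t = 0.

open import Defs
open import Data.Nat.Base using (ℕ; _*_; _∸_; _^_; _≤_; _<_)
open import Data.Nat.Divisibility using (_∣_)
open import Data.Integer.Base using (+_)
open import Data.Rational.Base using (_/_) renaming (_≤_ to _≤ℚ_)
open import Data.Product.Base using (_×_)
open import Relation.Binary.PropositionalEquality using (_≡_)
open import Relation.Nullary.Negation using (¬_)

open import Data.Bool.Base using (Bool; true; false; if_then_else_)
open import Data.Bool.Properties using (_≟_; T-irrelevant)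
open import Data.Empty using (⊥-elim)
open import Data.Fin.Base using (zero; suc)
open import Data.Integer.Base as ℤ using (+≤+)
open import Data.Integer.Properties using (pos-*)
open import Data.List.Base using (List; []; _∷_; _++_; map; length)
open import Data.List.Membership.Propositional using (mapWith∈) renaming (_∈_ to _∈ₗ_)
open import Data.List.Membership.Propositional.Properties
  using (∈-map⁺; ∈-map⁻; map-mapWith∈; mapWith∈-id)
open import Data.List.Membership.Propositional.Properties.WithK using (unique∧set⇒bag)
open import Data.List.Properties using (length-map; map-++; map-∘; map-cong)
open import Data.List.Relation.Binary.BagAndSetEquality using (∼bag⇒↭)
open import Data.List.Relation.Binary.Permutation.Propositional as Perm using (_↭_; prep; swap)
open import Data.List.Relation.Binary.Permutation.Propositional.Properties
  using (↭-length) renaming (map⁺ to ↭-map⁺)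
open import Data.List.Relation.Unary.All as All using (All; []; _∷_)
open import Data.List.Relation.Unary.Unique.Propositional using (Unique)
import Data.List.Relation.Unary.Unique.Propositional.Properties as Unique
open import Data.Maybe.Base using (just; nothing)
open import Data.Nat.Base using (zero; suc; _+_; z≤n; s≤s; NonZero)
open import Data.Nat.Divisibility using (m∣m*n)
open import Data.Nat.ListAction using (sum)
open import Data.Nat.ListAction.Properties using (sum-++; sum-↭)
open import Data.Nat.Properties
  using ( +-comm; +-suc; *-comm; *-suc; *-zeroʳ; *-identityʳ; *-distribʳ-+; *-distribˡ-+
        ; +-identityʳ; +-mono-≤; +-monoʳ-≤; m≤m*n; m≤m+n; ≤-trans; ≤-reflexive; ≤-pred
        ; ≤-total; m+[n∸m]≡n; m<m+n; <-≤-trans; <⇒≤pred; module ≤-Reasoning)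
open import Data.Nat.Solver using (module +-*-Solver)
open import Data.Product.Base using (_,_; proj₁; proj₂; uncurry)
open import Data.Rational.Base using (toℚᵘ)
open import Data.Rational.Properties using (toℚᵘ-cancel-≤; toℚᵘ-fromℚᵘ)
open import Data.Rational.Unnormalised.Base using (mkℚᵘ; *≤*)
import Data.Rational.Unnormalised.Properties as ℚᵘ
open import Data.Sum.Base using (inj₁; inj₂)
open import Data.Vec.Base using ([]; _∷_; head; tail; lookup; tabulate)
open import Data.Vec.Properties using (tabulate-cong)
open import Function.Base using (_∘_)
open import Function.Bundles using (module Bijection; mk⇔)
open import Relation.Binary.PropositionalEquality
  using (refl; sym; trans; cong; cong₂; subst; subst₂; module ≡-Reasoning)
open import Relation.Nullary.Decidable using (yes; no; does)

private
  variable
    n : ℕ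
    X Y : Set

-- Sums over unordered pairs of list entries.

pairSum : (X → X → ℕ) → List X → ℕ
pairSum f xs = sum (map (uncurry f) (pairs xs))

pairSum-∷ : ∀ (f : X → X → ℕ) x xs → pairSum f (x ∷ xs) ≡ sum (map (f x) xs) + pairSum f xs
pairSum-∷ f x xs = begin
  sum (map (uncurry f) (map (x ,_) xs ++ pairs xs))
    ≡⟨ cong sum (map-++ (uncurry f) (map (x ,_) xs) (pairs xs)) ⟩
  sum (map (uncurry f) (map (x ,_) xs) ++ map (uncurry f) (pairs xs))
    ≡⟨ sum-++ (map (uncurry f) (map (x ,_) xs)) _ ⟩
  sum (map (uncurry f) (map (x ,_) xs)) + pairSum f xs
    ≡⟨ cong (λ ys → sum ys + pairSum f xs) (map-∘ xs) ⟨
  sum (map (f x) xs) + pairSum f xs ∎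
  where open ≡-Reasoning

pairSum-cong : ∀ {f g : X → X → ℕ} → (∀ x y → f x y ≡ g x y) → ∀ xs → pairSum f xs ≡ pairSum g xs
pairSum-cong eq xs = cong sum (map-cong (uncurry eq) (pairs xs))

pairSum-map : ∀ (f : Y → Y → ℕ) (h : X → Y) xs →
              pairSum f (map h xs) ≡ pairSum (λ x y → f (h x) (h y)) xs
pairSum-map f h []       = refl
pairSum-map f h (x ∷ xs) = begin
  pairSum f (h x ∷ map h xs)
    ≡⟨ pairSum-∷ f (h x) (map h xs) ⟩
  sum (map (f (h x)) (map h xs)) + pairSum f (map h xs)
    ≡⟨ cong₂ _+_ (cong sum (map-∘ xs)) (sym (pairSum-map f h xs)) ⟨
  sum (map (λ y → f (h x) (h y)) xs) + pairSum (λ x y → f (h x) (h y)) xs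
    ≡⟨ pairSum-∷ (λ x y → f (h x) (h y)) x xs ⟨
  pairSum (λ x y → f (h x) (h y)) (x ∷ xs) ∎
  where open ≡-Reasoning

sum-map-+ : ∀ (f g : X → ℕ) xs → sum (map (λ x → f x + g x) xs) ≡ sum (map f xs) + sum (map g xs)
sum-map-+ f g []       = refl
sum-map-+ f g (x ∷ xs) rewrite sum-map-+ f g xs =
  solve 4 (λ a b c d → (a :+ b) :+ (c :+ d) := (a :+ c) :+ (b :+ d)) refl
    (f x) (g x) (sum (map f xs)) (sum (map g xs))
  where open +-*-Solver

-- A swap lists the two front entries as a pair in the opposite order, which is where the symmetry
-- of `f` enters; the other terms are only regrouped.
pairSum-↭ : ∀ {f : X → X → ℕ} → (∀ x y → f x y ≡ f y x) →
            ∀ {xs ys} → xs ↭ ys → pairSum f xs ≡ pairSum f ys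
pairSum-↭ f-sym Perm.refl = refl
pairSum-↭ {f = f} f-sym (prep {xs} {ys} x p)
  rewrite pairSum-∷ f x xs | pairSum-∷ f x ys =
  cong₂ _+_ (sum-↭ (↭-map⁺ (f x) p)) (pairSum-↭ f-sym p)
pairSum-↭ {f = f} f-sym (swap {xs} {ys} x y p)
  rewrite pairSum-∷ f x (y ∷ xs) | pairSum-∷ f y xs | pairSum-∷ f y (x ∷ ys) | pairSum-∷ f x ys
        | f-sym x y | sum-↭ (↭-map⁺ (f x) p) | sum-↭ (↭-map⁺ (f y) p) | pairSum-↭ f-sym p =
  solve 4 (λ a b c d → (a :+ b) :+ (c :+ d) := (a :+ c) :+ (b :+ d)) refl
    (f y x) (sum (map (f x) ys)) (sum (map (f y) ys)) (pairSum f ys)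
  where open +-*-Solver
pairSum-↭ f-sym (Perm.trans p q) = trans (pairSum-↭ f-sym p) (pairSum-↭ f-sym q)

-- Splitting the Hamming distance by coordinates.

mismatch : Bool → Bool → ℕ
mismatch a b = if does (a ≟ b) then 0 else 1

mismatch-sym : ∀ a b → mismatch a b ≡ mismatch b a
mismatch-sym true  true  = refl
mismatch-sym true  false = refl
mismatch-sym false true  = refl
mismatch-sym false false = refl

dH-∷ : ∀ a b (x y : Cube n) → dH (a ∷ x) (b ∷ y) ≡ mismatch a b + dH x y
dH-∷ true  true  x y = refl
dH-∷ true  false x y = refl
dH-∷ false true  x y = refl
dH-∷ false false x y = refl

dH-sym : ∀ (x y : Cube n) → dH x y ≡ dH y x
dH-sym []      []      = refl
dH-sym (a ∷ x) (b ∷ y) rewrite dH-∷ a b x y | dH-∷ b a y x = cong₂ _+_ (mismatch-sym a b) (dH-sym x y)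

-- The basis of the inductions on the dimension. Distinct vectors may have equal tails, so these
-- inductions run over lists with possible repetitions and not over subsets.
pairSum-dH : ∀ (xs : List (Cube (suc n))) →
             pairSum dH xs ≡ pairSum mismatch (map head xs) + pairSum dH (map tail xs)
pairSum-dH xs = begin
  pairSum dH xs
    ≡⟨ pairSum-cong (λ { (a ∷ x) (b ∷ y) → dH-∷ a b x y }) xs ⟩
  pairSum (λ x y → mismatch (head x) (head y) + dH (tail x) (tail y)) xs
    ≡⟨ sum-map-+ (λ (x , y) → mismatch (head x) (head y)) (λ (x , y) → dH (tail x) (tail y)) (pairs xs) ⟩
  pairSum (λ x y → mismatch (head x) (head y)) xs + pairSum (λ x y → dH (tail x) (tail y)) xs
    ≡⟨ cong₂ _+_ (pairSum-map mismatch head xs) (pairSum-map dH tail xs) ⟨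
  pairSum mismatch (map head xs) + pairSum dH (map tail xs) ∎
  where open ≡-Reasoning

-- Pair sums of a single column of bits.

-- `mismatches false` counts the ones of a column and `mismatches true` its zeros: the numbers s and
-- t.
mismatches : Bool → List Bool → ℕ
mismatches a bs = sum (map (mismatch a) bs)

mismatches-+ : ∀ bs → mismatches true bs + mismatches false bs ≡ length bs
mismatches-+ []           = refl
mismatches-+ (true ∷ bs)  = trans (+-suc _ _) (cong suc (mismatches-+ bs))
mismatches-+ (false ∷ bs) = cong suc (mismatches-+ bs)

-- A new front bit differs exactly from the entries of the other kind. It raises the count of its
-- own kind by one, and so the product by the count of the other kind.
pairSum-mismatch : ∀ bs → pairSum mismatch bs ≡ mismatches true bs * mismatches false bs
pairSum-mismatch []           = refl
pairSum-mismatch (true ∷ bs)  = begin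
  pairSum mismatch (true ∷ bs)
    ≡⟨ pairSum-∷ mismatch true bs ⟩
  mismatches true bs + pairSum mismatch bs
    ≡⟨ cong (λ p → mismatches true bs + p) (pairSum-mismatch bs) ⟩
  mismatches true bs + mismatches true bs * mismatches false bs
    ≡⟨ *-suc (mismatches true bs) _ ⟨
  mismatches true bs * suc (mismatches false bs) ∎
  where open ≡-Reasoning
pairSum-mismatch (false ∷ bs) =
  trans (pairSum-∷ mismatch false bs) (cong (λ p → mismatches false bs + p) (pairSum-mismatch bs))

mismatches≡0 : ∀ {a bs} → All (a ≡_) bs → mismatches a bs ≡ 0
mismatches≡0         []              = refl
mismatches≡0 {true}  (refl ∷ a≡bs) = mismatches≡0 a≡bs
mismatches≡0 {false} (refl ∷ a≡bs) = mismatches≡0 a≡bs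

mismatches>0 : ∀ {a} bs → ¬ All (a ≡_) bs → 0 < mismatches a bs
mismatches>0 [] ¬all = ⊥-elim (¬all [])
mismatches>0 {a} (b ∷ bs) ¬all with a ≟ b
... | no  _    = s≤s z≤n
... | yes refl = mismatches>0 bs (¬all ∘ (refl ∷_))

-- A rearrangement of 0 ≤ (m - 1)(n - 1).
m+n≤1+m*n : ∀ {m n} → 0 < m → 0 < n → m + n ≤ suc (m * n)
m+n≤1+m*n {suc m} {suc n} _ _ = s≤s (begin
  m + suc n         ≡⟨ +-comm m (suc n) ⟩
  suc n + m         ≤⟨ +-monoʳ-≤ (suc n) (m≤m*n m (suc n)) ⟩
  suc n + m * suc n ∎)
  where open ≤-Reasoning

-- Both bits occur, `b` at the front and the other one in `bs`, so both counts are positive. They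
-- add up to `suc (length bs)`, and the `suc` cancels against the one in `m+n≤1+m*n`.
nonconstant-column : ∀ b bs → ¬ All (b ≡_) bs → length bs ≤ pairSum mismatch (b ∷ bs)
nonconstant-column b bs ¬all = ≤-pred (begin
  length (b ∷ bs)                                          ≡⟨ mismatches-+ (b ∷ bs) ⟨
  mismatches true (b ∷ bs) + mismatches false (b ∷ bs)     ≤⟨ uncurry m+n≤1+m*n (both b ¬all) ⟩
  suc (mismatches true (b ∷ bs) * mismatches false (b ∷ bs)) ≡⟨ cong suc (pairSum-mismatch (b ∷ bs)) ⟨
  suc (pairSum mismatch (b ∷ bs))                          ∎)
  where
  open ≤-Reasoning
  both : ∀ b → ¬ All (b ≡_) bs → (0 < mismatches true (b ∷ bs)) × (0 < mismatches false (b ∷ bs))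
  both true  ¬all = mismatches>0 bs ¬all , s≤s z≤n
  both false ¬all = s≤s z≤n , mismatches>0 bs ¬all

constant-column : ∀ {b bs} → All (b ≡_) bs → pairSum mismatch (b ∷ bs) ≡ 0
constant-column {b} {bs} all = trans (pairSum-mismatch (b ∷ bs)) (zero-product b all)
  where
  zero-product : ∀ b → All (b ≡_) bs → mismatches true (b ∷ bs) * mismatches false (b ∷ bs) ≡ 0
  zero-product true  all rewrite mismatches≡0 all = refl
  zero-product false all rewrite mismatches≡0 all = *-zeroʳ (mismatches true bs)

-- The rank as a sum over coordinates.

-- `rank A` is `rankOf (elements A)` definitionally.
rankOf : List (Cube n) → ℕ
rankOf xs = dim (tabulate λ i → commonValue (map (λ x → lookup x i) xs))

-- The contribution of one column to the rank: 0 if it is constant and non-empty, otherwise 1.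
varies : List Bool → ℕ
varies bs = dim (commonValue bs ∷ [])

dim-∷ : ∀ m (F : Face n) → dim (m ∷ F) ≡ dim (m ∷ []) + dim F
dim-∷ (just _) F = refl
dim-∷ nothing  F = refl

rankOf-suc : ∀ (xs : List (Cube (suc n))) → rankOf xs ≡ varies (map head xs) + rankOf (map tail xs)
rankOf-suc {n} xs = trans
  (cong₂ (λ bs F → dim (commonValue bs ∷ F))
    (map-cong lookup-zero xs)
    (tabulate-cong λ i → cong commonValue
      (trans (map-cong (lookup-suc i) xs) (map-∘ xs))))
  (dim-∷ (commonValue (map head xs)) (tabulate λ i → commonValue (map (λ x → lookup x i) (map tail xs))))
  where
  lookup-zero : (x : Cube (suc n)) → lookup x zero ≡ head x
  lookup-zero (_ ∷ _) = refl
  lookup-suc : ∀ i (x : Cube (suc n)) → lookup x (suc i) ≡ lookup (tail x) i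
  lookup-suc _ (_ ∷ _) = refl

-- Bounds for one column, summed over all coordinates.

varies-upper : ∀ bs → varies bs * (length bs ∸ 1) ≤ pairSum mismatch bs
-- Here `varies []` is 1, but the truncated `0 ∸ 1` makes the product 0.
varies-upper []       = z≤n
varies-upper (b ∷ bs) with All.all? (b ≟_) bs
... | yes _    = z≤n
... | no  ¬all = ≤-trans (≤-reflexive (+-identityʳ (length bs))) (nonconstant-column b bs ¬all)

-- `M` stands for either denominator, |A|² or |A|² - 1, so the even and the odd case share one
-- argument. A constant column makes the left side 0; any other has `varies` equal to 1, and `bound`
-- applies to its two counts.
varies-lower : ∀ bs {M} → (∀ s t → s + t ≡ length bs → 4 * (s * t) ≤ M) →
               4 * pairSum mismatch bs ≤ varies bs * M
varies-lower []       bound = z≤n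
varies-lower (b ∷ bs) {M} bound with All.all? (b ≟_) bs
... | yes all = ≤-reflexive (cong (4 *_) (constant-column all))
... | no  _   = begin
  4 * pairSum mismatch (b ∷ bs)
    ≡⟨ cong (4 *_) (pairSum-mismatch (b ∷ bs)) ⟩
  4 * (mismatches true (b ∷ bs) * mismatches false (b ∷ bs))
    ≤⟨ bound (mismatches true (b ∷ bs)) (mismatches false (b ∷ bs)) (mismatches-+ (b ∷ bs)) ⟩
  M ≡⟨ +-identityʳ M ⟨
  1 * M ∎
  where open ≤-Reasoning

rankOf-upper : ∀ (xs : List (Cube n)) → rankOf xs * (length xs ∸ 1) ≤ pairSum dH xs
rankOf-upper {zero}  xs = z≤n
rankOf-upper {suc n} xs = begin
  rankOf xs * k                       ≡⟨ cong (_* k) (rankOf-suc xs) ⟩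
  (varies hs + rankOf ts) * k         ≡⟨ *-distribʳ-+ k (varies hs) (rankOf ts) ⟩
  varies hs * k + rankOf ts * k       ≡⟨ cong₂ (λ l m → varies hs * (l ∸ 1) + rankOf ts * (m ∸ 1))
                                           (length-map head xs) (length-map tail xs) ⟨
  varies hs * (length hs ∸ 1) + rankOf ts * (length ts ∸ 1)
                                      ≤⟨ +-mono-≤ (varies-upper hs) (rankOf-upper ts) ⟩
  pairSum mismatch hs + pairSum dH ts ≡⟨ pairSum-dH xs ⟨
  pairSum dH xs                       ∎
  where
  open ≤-Reasoning
  k  = length xs ∸ 1
  hs = map head xs
  ts = map tail xs

pairSum-dH-[] : ∀ (xs : List (Cube 0)) → pairSum dH xs ≡ 0
pairSum-dH-[] xs = zeros (pairs xs)
  where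
  zeros : ∀ ps → sum (map (uncurry dH) ps) ≡ 0
  zeros []               = refl
  zeros (([] , []) ∷ ps) = zeros ps

rankOf-lower : ∀ (xs : List (Cube n)) {M} → (∀ s t → s + t ≡ length xs → 4 * (s * t) ≤ M) →
               4 * pairSum dH xs ≤ rankOf xs * M
rankOf-lower {zero}  xs bound = ≤-reflexive (cong (4 *_) (pairSum-dH-[] xs))
rankOf-lower {suc n} xs {M} bound = begin
  4 * pairSum dH xs                             ≡⟨ cong (4 *_) (pairSum-dH xs) ⟩
  4 * (pairSum mismatch hs + pairSum dH ts)     ≡⟨ *-distribˡ-+ 4 (pairSum mismatch hs) _ ⟩
  4 * pairSum mismatch hs + 4 * pairSum dH ts
    ≤⟨ +-mono-≤ (varies-lower hs λ s t eq → bound s t (trans eq (length-map head xs)))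
                (rankOf-lower ts λ s t eq → bound s t (trans eq (length-map tail xs))) ⟩
  varies hs * M + rankOf ts * M                 ≡⟨ *-distribʳ-+ M (varies hs) (rankOf ts) ⟨
  (varies hs + rankOf ts) * M                   ≡⟨ cong (_* M) (rankOf-suc xs) ⟨
  rankOf xs * M                                 ∎
  where
  open ≤-Reasoning
  hs = map head xs
  ts = map tail xs

-- `rankOf-upper` says nothing here, as its factor `length xs ∸ 1` is 0. Instead, `varies` of a
-- one-entry column computes to 0 in each coordinate.
rankOf-singleton : ∀ (xs : List (Cube n)) → length xs ≡ 1 → rankOf xs ≡ 0
rankOf-singleton {zero}  xs       _    = refl
rankOf-singleton {suc n} (x ∷ []) refl =
  trans (rankOf-suc (x ∷ [])) (rankOf-singleton (tail x ∷ []) refl)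

-- Comparison of 4 s t with (s + t)².

-- The identity 4 s t + (t - s)² = (s + t)², with t = s + k to avoid subtraction.
square-split : ∀ s k → 4 * (s * (s + k)) + k * k ≡ (s + (s + k)) ^ 2
square-split = solve 2 (λ s k →
  con 4 :* (s :* (s :+ k)) :+ k :* k :=
  (s :+ (s :+ k)) :* ((s :+ (s :+ k)) :* con 1)) refl
  where open +-*-Solver

wlog-offset : ∀ {P : ℕ → ℕ → Set} → (∀ s t → P s t → P t s) → (∀ s k → P s (s + k)) →
              ∀ s t → P s t
wlog-offset {P} P-sym P-offset s t with ≤-total s t
... | inj₁ s≤t = subst (P s) (m+[n∸m]≡n s≤t) (P-offset s (t ∸ s))
... | inj₂ t≤s = P-sym t s (subst (P t) (m+[n∸m]≡n t≤s) (P-offset t (s ∸ t)))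

4st≤[s+t]² : ∀ s t → 4 * (s * t) ≤ (s + t) ^ 2
4st≤[s+t]² = wlog-offset
  (λ s t → subst₂ (λ p q → 4 * p ≤ q ^ 2) (*-comm s t) (+-comm s t))
  (λ s k → ≤-trans (m≤m+n _ (k * k)) (≤-reflexive (square-split s k)))

4st<[s+t]² : ∀ s t → ¬ (2 ∣ s + t) → 4 * (s * t) < (s + t) ^ 2
4st<[s+t]² = wlog-offset
  (λ s t → subst₂ (λ p q → ¬ (2 ∣ q) → 4 * p < q ^ 2) (*-comm s t) (+-comm s t))
  offset
  where
  offset : ∀ s k → ¬ (2 ∣ s + (s + k)) → 4 * (s * (s + k)) < (s + (s + k)) ^ 2
  -- `s + (s + 0)` is what `2 * s` unfolds to, so an odd sum excludes k = 0. For k > 0 the summand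
  -- `k * k` gives strictness.
  offset s zero    odd = ⊥-elim (odd (m∣m*n s))
  offset s (suc k) odd = <-≤-trans (m<m+n _ (s≤s z≤n)) (≤-reflexive (square-split s (suc k)))

-- Inequalities between fractions.

-- `/` reduces to lowest terms; the passage to unnormalised rationals restores the given numerators
-- and denominators for cross-multiplication.
/-≤-/ : ∀ a b c d .{{_ : NonZero b}} .{{_ : NonZero d}} → a * d ≤ c * b → (+ a) / b ≤ℚ (+ c) / d
/-≤-/ a (suc b) c (suc d) ad≤cb = toℚᵘ-cancel-≤ (begin
  toℚᵘ ((+ a) / suc b) ≃⟨ toℚᵘ-fromℚᵘ (mkℚᵘ (+ a) b) ⟩
  mkℚᵘ (+ a) b         ≤⟨ *≤* (subst₂ ℤ._≤_ (pos-* a (suc d)) (pos-* c (suc b)) (+≤+ ad≤cb)) ⟩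
  mkℚᵘ (+ c) d         ≃⟨ toℚᵘ-fromℚᵘ (mkℚᵘ (+ c) d) ⟨
  toℚᵘ ((+ c) / suc d) ∎)
  where open ℚᵘ.≤-Reasoning

-- Invariance of cardinality and distance sum under isometry.

Elem-≡ : ∀ {A : Subset n} {a a′ : Elem A} → proj₁ a ≡ proj₁ a′ → a ≡ a′
Elem-≡ refl = cong (_ ,_) (T-irrelevant _ _)

-- An isometry acts on `Elem A`, so each vector has to carry its membership proof before the
-- isometry can be mapped over the list.
elemList : (A : Subset n) → List (Elem A)
elemList A = mapWith∈ (elements A) λ {x} x∈ → x , ∈-elements⁻ A x∈

map-proj₁-elemList : (A : Subset n) → map proj₁ (elemList A) ≡ elements A
map-proj₁-elemList A = trans (map-mapWith∈ (elements A) _ proj₁) (mapWith∈-id (elements A))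

elemList-unique : (A : Subset n) → Unique (elemList A)
elemList-unique A = Unique.map⁻ (subst Unique (sym (map-proj₁-elemList A)) (elements-unique A))

∈-elemList : (A : Subset n) (a : Elem A) → a ∈ₗ elemList A
∈-elemList A (x , x∈A)
  with _ , a′∈ , eq ← ∈-map⁻ proj₁ (subst (x ∈ₗ_) (sym (map-proj₁-elemList A)) (∈-elements⁺ A x∈A))
  = subst (_∈ₗ elemList A) (Elem-≡ {A = A} (sym eq)) a′∈

module _ {A B : Subset n} (iso : Isometric A B) where

  open Bijection (proj₁ iso) using (to; injective; strictlySurjective)

  -- Injectivity keeps the image list free of duplicates and surjectivity makes it exhaust `Elem B`;
  -- duplicate-free lists with the same members are permutations of each other.
  map-to-↭ : map to (elemList A) ↭ elemList B
  map-to-↭ = ∼bag⇒↭ (unique∧set⇒bag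
    (Unique.map⁺ injective (elemList-unique A))
    (elemList-unique B)
    (λ {b} → mk⇔ (λ _ → ∈-elemList B b) (λ _ → to-∈ b)))
    where
    to-∈ : ∀ b → b ∈ₗ map to (elemList A)
    to-∈ b with a , eq ← strictlySurjective b =
      subst (_∈ₗ map to (elemList A)) eq (∈-map⁺ to (∈-elemList A a))

  isometric-card : card A ≡ card B
  isometric-card = begin
    length (elements A)             ≡⟨ cong length (map-proj₁-elemList A) ⟨
    length (map proj₁ (elemList A)) ≡⟨ length-map proj₁ (elemList A) ⟩
    length (elemList A)             ≡⟨ length-map to (elemList A) ⟨
    length (map to (elemList A))    ≡⟨ ↭-length map-to-↭ ⟩
    length (elemList B)             ≡⟨ length-map proj₁ (elemList B) ⟨
    length (map proj₁ (elemList B)) ≡⟨ cong length (map-proj₁-elemList B) ⟩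
    length (elements B)             ∎
    where open ≡-Reasoning

  isometric-D : D A ≡ D B
  isometric-D = begin
    pairSum dH (elements A)             ≡⟨ cong (pairSum dH) (map-proj₁-elemList A) ⟨
    pairSum dH (map proj₁ (elemList A)) ≡⟨ pairSum-map dH proj₁ (elemList A) ⟩
    pairSum dist (elemList A)           ≡⟨ pairSum-cong (proj₂ iso) (elemList A) ⟩
    pairSum (λ a a′ → dist (to a) (to a′)) (elemList A)
                                        ≡⟨ pairSum-map dist to (elemList A) ⟨
    pairSum dist (map to (elemList A))  ≡⟨ pairSum-↭ (λ b b′ → dH-sym (proj₁ b) (proj₁ b′)) map-to-↭ ⟩
    pairSum dist (elemList B)           ≡⟨ pairSum-map dH proj₁ (elemList B) ⟨
    pairSum dH (map proj₁ (elemList B)) ≡⟨ cong (pairSum dH) (map-proj₁-elemList B) ⟩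
    pairSum dH (elements B)             ∎
    where
    open ≡-Reasoning
    dist : ∀ {C : Subset n} → Elem C → Elem C → ℕ
    dist a a′ = dH (proj₁ a) (proj₁ a′)

theorem1 : (n : ℕ) → 1 ≤ n → (A : Subset n) → 1 ≤ card A →
    (B : Subset n) → Isometric A B →
    (card A ≡ 1 → rank B ≡ 0)
    × ((1<∣A∣ : 1 < card A) → 2 ∣ card A →
    (_/_ (+ (4 * D A)) (card A ^ 2) {{1<m⇒m^2≢0 1<∣A∣}} ≤ℚ (+ rank B) / 1)
    × ((+ rank B) / 1 ≤ℚ _/_ (+ D A) (card A ∸ 1) {{1<m⇒m∸1≢0 1<∣A∣}}))
    × ((1<∣A∣ : 1 < card A) → ¬ (2 ∣ card A) →
    (_/_ (+ (4 * D A)) (card A ^ 2 ∸ 1) {{1<m⇒m^2∸1≢0 1<∣A∣}} ≤ℚ (+ rank B) / 1)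
    × ((+ rank B) / 1 ≤ℚ _/_ (+ D A) (card A ∸ 1) {{1<m⇒m∸1≢0 1<∣A∣}}))
theorem1 n _ A _ B iso =
    (λ card≡1 → rankOf-singleton (elements B) (trans (sym card≡) card≡1))
  , (λ 1<∣A∣ _ →
        lower (card A ^ 2) {{1<m⇒m^2≢0 1<∣A∣}}
          (λ s t eq → subst (λ m → 4 * (s * t) ≤ m ^ 2) eq (4st≤[s+t]² s t))
      , upper 1<∣A∣)
  , (λ 1<∣A∣ odd →
        lower (card A ^ 2 ∸ 1) {{1<m⇒m^2∸1≢0 1<∣A∣}}
          -- The strict inequality between naturals supplies the `∸ 1` of the odd denominator.
          (λ s t eq → <⇒≤pred (subst (λ m → 4 * (s * t) < m ^ 2) eq
             (4st<[s+t]² s t (subst (λ m → ¬ (2 ∣ m)) (sym eq) odd))))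
      , upper 1<∣A∣)
  where
  open ≤-Reasoning

  card≡ : card A ≡ card B
  card≡ = isometric-card {A = A} {B} iso

  D≡ : D A ≡ D B
  D≡ = isometric-D {A = A} {B} iso

  lower : ∀ M .{{_ : NonZero M}} → (∀ s t → s + t ≡ card A → 4 * (s * t) ≤ M) →
          (+ (4 * D A)) / M ≤ℚ (+ rank B) / 1
  lower M bound = /-≤-/ (4 * D A) M (rank B) 1 (begin
    4 * D A * 1 ≡⟨ *-identityʳ (4 * D A) ⟩
    4 * D A     ≡⟨ cong (4 *_) D≡ ⟩
    4 * D B     ≤⟨ rankOf-lower (elements B) (λ s t eq → bound s t (trans eq (sym card≡))) ⟩
    rank B * M  ∎)

  upper : (1<∣A∣ : 1 < card A) →
          (+ rank B) / 1 ≤ℚ _/_ (+ D A) (card A ∸ 1) {{1<m⇒m∸1≢0 1<∣A∣}}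
  upper 1<∣A∣ = /-≤-/ (rank B) 1 (D A) (card A ∸ 1) {{_}} {{1<m⇒m∸1≢0 1<∣A∣}} (begin
    rank B * (card A ∸ 1) ≡⟨ cong (λ m → rank B * (m ∸ 1)) card≡ ⟩
    rank B * (card B ∸ 1) ≤⟨ rankOf-upper (elements B) ⟩
    D B                   ≡⟨ D≡ ⟨
    D A                   ≡⟨ *-identityʳ (D A) ⟨
    D A * 1               ∎)
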